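{- Let $\mathbf C$ be a nonempty class of pointed countably based FS-domains. Then the following conditions are equivalent: (1) $\mathcal F(\mathbf C)$ is Cartesian closed; (2) for all $C_1,C_2\in\mathbf C$, $C_1\times C_2\in\mathcal F(\mathbf C)$ and $[C_1\to C_2]\in\mathcal F(\mathbf C)$.
   Context: A dcpo is a poset in which every (nonempty) directed subset has a supremum; it is pointed if it has a least element. $\mathbf{DCPO}$ is the category of dcpos and Scott-continuous maps (monotone maps preserving directed suprema). $[D\to E]$ is the dcpo of Scott-continuous maps ordered pointwise, and $D\times E$ is the Cartesian product with componentwise order. $a\ll b$ means: whenever $b\leq\sup E$ with $E$ directed, some $e\in E$ has $a\leq e$. $D$ is countably based if it has a countable subset $B$ such that for each $x\in D$ the set $\{b\in B:b\ll x\}$ is directed with supremum $x$. A Scott-continuous $f:D\to D$ is finitely separated from the identity if there is a finite $M\subseteq D$ such that for every $x\in D$ some $m\in M$ satisfies $f(x)\leq m\leq x$. $D$ is an FS-domain if there is a pointwise-directed family of Scott-continuous self-maps, each finitely separated from the identity, with pointwise supremum $\mathrm{id}_D$. For a nonempty class $\mathbf C$ of dcpos, $\mathcal F(\mathbf C)$ is the full subcategory of $\mathbf{DCPO}$ of those dcpos $D$ for which there is a sequence $a_n=e_n\circ p_n$ ($n\in\mathbb N$) with Scott-continuous $p_n:D\to C_n$, $e_n:C_n\to D$, $C_n\in\mathbf C$, such that $a_n\leq a_{n+1}\leq\mathrm{id}_D$ and $\sup_n a_n=\mathrm{id}_D$ pointwise. Known fact about the meaning of (1): a full subcategory of $\mathbf{DCPO}$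 is Cartesian closed iff its terminal object, binary products and exponentials exist and are (up to order-isomorphism) the one-point dcpo, the Cartesian product $A_1\times A_2$, and the function space $[A_1\to A_2]$. -}

module Defs where

open import Axiom.ExcludedMiddle using (ExcludedMiddle)
open import Data.Bool.Base using (Bool; T)
open import Data.List.Base using (List)
open import Data.List.Relation.Unary.Any using (Any)
open import Data.Nat.Base as ℕ using (ℕ)
open import Data.Product.Base using (Σ; ∃; _×_; _,_; proj₁; proj₂)
open import Data.Product.Relation.Binary.Pointwise.NonDependent using (×-poset)
open import Function.Bundles using (Equivalence; Injection; _⇔_; mk⇔)
open import Level using (_⊔_; suc)
open import Relation.Binary.Bundles using (Poset)
open import Relation.Binary.Core using (Rel)
import Relation.Binary.Construct.On as On
open import Relation.Binary.PropositionalEquality as ≡ using ()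
open import Relation.Binary.Structures using (IsEquivalence)
open import Relation.Nullary.Decidable using (⌊_⌋; toWitness; fromWitness)
open import Relation.Unary using (Pred)

-- The theory is classical.  Under excluded middle every predicate is,
-- up to logical equivalence, a Boolean-valued one (see `decideSubset`),
-- so quantifying over all subsets of a type may be done by quantifying
-- over `Subset`.  Scott continuity and ≪ are stated that way: since
-- `Subset A` lies in the universe of `A`, the Scott-continuous maps between
-- two dcpos in `Set ℓ` again form a type in `Set ℓ`.

Subset : ∀ {a} → Set a → Set a
Subset A = A → Bool

⟦_⟧ : ∀ {a} {A : Set a} → Subset A → A → Set
⟦ S ⟧ x = T (S x)

decideSubset : ∀ {a ℓ} {A : Set a} → ExcludedMiddle ℓ → (P : Pred A ℓ) →
               ∃ λ (S : Subset A) → ∀ x → ⟦ S ⟧ x ⇔ P x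
decideSubset em P =
  (λ x → ⌊ em {P x} ⌋) ,
  (λ x → mk⇔ (toWitness {a? = em {P x}}) (fromWitness {a? = em {P x}}))

module _ {c ℓ₁ ℓ₂} (P : Poset c ℓ₁ ℓ₂) where
  open Poset P

  IsDirected : ∀ {a} → Pred Carrier a → Set (c ⊔ ℓ₂ ⊔ a)
  IsDirected A =
    ∃ A × (∀ {x y} → A x → A y → ∃ λ z → A z × x ≤ z × y ≤ z)

  IsSup : ∀ {a} → Pred Carrier a → Carrier → Set (c ⊔ ℓ₂ ⊔ a)
  IsSup A s = (∀ {x} → A x → x ≤ s) × (∀ u → (∀ {x} → A x → x ≤ u) → s ≤ u)

  -- The range {f i | i ∈ A}.
  Image : ∀ {i a} {I : Set i} → (I → Carrier) → Pred I a →
          Pred Carrier (i ⊔ ℓ₁ ⊔ a)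
  Image f A y = ∃ λ i → A i × y ≈ f i

  Range : ∀ {i} {I : Set i} → (I → Carrier) → Pred Carrier (i ⊔ ℓ₁)
  Range f y = ∃ λ i → y ≈ f i

record Dcpo ℓ : Set (suc ℓ) where
  field
    poset    : Poset ℓ ℓ ℓ
  open Poset poset public
  field
    complete : (A : Pred Carrier ℓ) → IsDirected poset A → ∃ (IsSup poset A)

module _ {ℓ} (D : Dcpo ℓ) where
  open Dcpo D

  Pointed : Set ℓ
  Pointed = ∃ λ ⊥ → ∀ x → ⊥ ≤ x

  WayBelow : Rel Carrier ℓ
  WayBelow a b =
    (E : Subset Carrier) → IsDirected poset ⟦ E ⟧ →
    ∀ s → IsSup poset ⟦ E ⟧ s → b ≤ s → ∃ λ e → ⟦ E ⟧ e × a ≤ e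

  -- Countable, up to ≈: finite and empty sets are included.
  IsCountable : Pred Carrier ℓ → Set ℓ
  IsCountable B =
    Injection (On.setoid Eq.setoid (proj₁ {B = B})) (≡.setoid ℕ)

  CountablyBased : Set (suc ℓ)
  CountablyBased =
    ∃ λ (B : Pred Carrier ℓ) → IsCountable B ×
      (∀ x → let B≪x = λ b → B b × WayBelow b x in
             IsDirected poset B≪x × IsSup poset B≪x x)

record ScottMap {ℓ} (D E : Dcpo ℓ) : Set ℓ where
  private
    module D = Dcpo D
    module E = Dcpo E
  field
    to       : D.Carrier → E.Carrier
    mono     : ∀ {x y} → x D.≤ y → to x E.≤ to y
    pres-sup : (S : Subset D.Carrier) → IsDirected D.poset ⟦ S ⟧ →
               ∀ s → IsSup D.poset ⟦ S ⟧ s →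
               IsSup E.poset (Image E.poset to ⟦ S ⟧) (to s)

  cong : ∀ {x y} → x D.≈ y → to x E.≈ to y
  cong x≈y = E.antisym (mono (D.reflexive x≈y))
                       (mono (D.reflexive (D.Eq.sym x≈y)))

open ScottMap public using (to)

infixr 2 _×ᵈ_
infixr 1 _⇒ᵈ_

_×ᵈ_ : ∀ {ℓ} → Dcpo ℓ → Dcpo ℓ → Dcpo ℓ
_×ᵈ_ {ℓ} D E = record { poset = P ; complete = sup }
  where
  module D = Dcpo D
  module E = Dcpo E
  P : Poset ℓ ℓ ℓ
  P = ×-poset D.poset E.poset

  sup : (A : Pred (Poset.Carrier P) ℓ) → IsDirected P A → ∃ (IsSup P A)
  sup A ((p , p∈A) , dir) =
    let (s , s-ub , s-least) = D.complete A₁ dir₁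
        (t , t-ub , t-least) = E.complete A₂ dir₂
    in (s , t) ,
       (λ q∈A → s-ub (_ , q∈A) , t-ub (_ , q∈A)) ,
       (λ (u , v) ub → s-least u (λ (_ , q∈A) → proj₁ (ub q∈A)) ,
                       t-least v (λ (_ , q∈A) → proj₂ (ub q∈A)))
    where
    A₁ : Pred D.Carrier ℓ
    A₁ x = ∃ λ y → A (x , y)
    A₂ : Pred E.Carrier ℓ
    A₂ y = ∃ λ x → A (x , y)
    dir₁ : IsDirected D.poset A₁
    dir₁ = (_ , _ , p∈A) , λ (_ , q∈A) (_ , r∈A) →
      let (z , z∈A , q≤z , r≤z) = dir q∈A r∈A
      in proj₁ z , (_ , z∈A) , proj₁ q≤z , proj₁ r≤z
    dir₂ : IsDirected E.poset A₂
    dir₂ = (_ , _ , p∈A) , λ (_ , q∈A) (_ , r∈A) →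
      let (z , z∈A , q≤z , r≤z) = dir q∈A r∈A
      in proj₂ z , (_ , z∈A) , proj₂ q≤z , proj₂ r≤z

scottPoset : ∀ {ℓ} → Dcpo ℓ → Dcpo ℓ → Poset ℓ ℓ ℓ
scottPoset D E = record
  { Carrier        = ScottMap D E
  ; _≈_            = λ f g → ∀ x → to f x E.≈ to g x
  ; _≤_            = λ f g → ∀ x → to f x E.≤ to g x
  ; isPartialOrder = record
    { isPreorder = record
      { isEquivalence = record
        { refl  = λ x → E.Eq.refl
        ; sym   = λ f≈g x → E.Eq.sym (f≈g x)
        ; trans = λ f≈g g≈h x → E.Eq.trans (f≈g x) (g≈h x)
        }
      ; reflexive  = λ f≈g x → E.reflexive (f≈g x)
      ; trans      = λ f≤g g≤h x → E.trans (f≤g x) (g≤h x)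
      }
    ; antisym    = λ f≤g g≤f x → E.antisym (f≤g x) (g≤f x)
    }
  }
  where module E = Dcpo E

_⇒ᵈ_ : ∀ {ℓ} → Dcpo ℓ → Dcpo ℓ → Dcpo ℓ
_⇒ᵈ_ {ℓ} D E = record { poset = P ; complete = sup }
  where
  module D = Dcpo D
  module E = Dcpo E
  P : Poset ℓ ℓ ℓ
  P = scottPoset D E

  sup : (A : Pred (ScottMap D E) ℓ) → IsDirected P A → ∃ (IsSup P A)
  sup A ((f₀ , f₀∈A) , dir) =
    record { to = ⋁ ; mono = ⋁-mono ; pres-sup = ⋁-pres } ,
    (λ f∈A x → ⋁-ub f∈A x) ,
    (λ g g-ub x → ⋁-least x (to g x) (λ f∈A → g-ub f∈A x))
    where
    at : D.Carrier → Pred E.Carrier ℓ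
    at x = Image E.poset (λ f → to f x) A

    at-dir : ∀ x → IsDirected E.poset (at x)
    at-dir x = (_ , _ , f₀∈A , E.Eq.refl) ,
      λ (f , f∈A , y≈fx) (g , g∈A , z≈gx) →
        let (h , h∈A , f≤h , g≤h) = dir f∈A g∈A
        in to h x , (h , h∈A , E.Eq.refl) ,
           E.trans (E.reflexive y≈fx) (f≤h x) ,
           E.trans (E.reflexive z≈gx) (g≤h x)

    ⋁ : D.Carrier → E.Carrier
    ⋁ x = proj₁ (E.complete (at x) (at-dir x))

    ⋁-ub : ∀ {f} → A f → ∀ x → to f x E.≤ ⋁ x
    ⋁-ub f∈A x =
      proj₁ (proj₂ (E.complete (at x) (at-dir x))) (_ , f∈A , E.Eq.refl)

    ⋁-least : ∀ x u → (∀ {f} → A f → to f x E.≤ u) → ⋁ x E.≤ u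
    ⋁-least x u u-ub = proj₂ (proj₂ (E.complete (at x) (at-dir x))) u
      λ (f , f∈A , y≈fx) → E.trans (E.reflexive y≈fx) (u-ub f∈A)

    ⋁-mono : ∀ {x y} → x D.≤ y → ⋁ x E.≤ ⋁ y
    ⋁-mono {x} {y} x≤y = ⋁-least x (⋁ y) λ {f} f∈A →
      E.trans (ScottMap.mono f x≤y) (⋁-ub f∈A y)

    ⋁-pres : (S : Subset D.Carrier) → IsDirected D.poset ⟦ S ⟧ →
             ∀ s → IsSup D.poset ⟦ S ⟧ s →
             IsSup E.poset (Image E.poset ⋁ ⟦ S ⟧) (⋁ s)
    ⋁-pres S S-dir s s-sup =
      (λ (x , x∈S , y≈⋁x) →
         E.trans (E.reflexive y≈⋁x) (⋁-mono (proj₁ s-sup x∈S))) ,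
      (λ u u-ub → ⋁-least s u λ {f} f∈A →
         proj₂ (ScottMap.pres-sup f S S-dir s s-sup) u
           λ (x , x∈S , y≈fx) →
             E.trans (E.reflexive y≈fx)
               (E.trans (⋁-ub f∈A x) (u-ub (x , x∈S , E.Eq.refl))))

module _ {ℓ} (D : Dcpo ℓ) where
  open Dcpo D

  FinitelySeparated : ScottMap D D → Set ℓ
  FinitelySeparated f =
    ∃ λ (M : List Carrier) → ∀ x → Any (λ m → to f x ≤ m × m ≤ x) M

  IsFSDomain : Set (suc ℓ)
  IsFSDomain =
    ∃ λ (F : Pred (ScottMap D D) ℓ) →
      IsDirected (scottPoset D D) F ×
      (∀ {f} → F f → FinitelySeparated f) ×
      (∀ x → IsSup poset (Image poset (λ f → to f x) F) x)

-- The maps aₙ = eₙ ∘ pₙ are given by their values; see `composeˢ` for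
-- their continuity.
record 𝓕 {ℓ c} (C : Dcpo ℓ → Set c) (D : Dcpo ℓ) : Set (suc ℓ ⊔ c) where
  open Dcpo D
  field
    obj   : ℕ → Dcpo ℓ
    obj∈C : ∀ n → C (obj n)
    p     : ∀ n → ScottMap D (obj n)
    e     : ∀ n → ScottMap (obj n) D

  a : ℕ → Carrier → Carrier
  a n x = to (e n) (to (p n) x)

  field
    a-increasing : ∀ n x → a n x ≤ a (ℕ.suc n) x
    a≤id         : ∀ n x → a n x ≤ x
    sup-a        : ∀ x → IsSup poset (Range poset (λ n → a n x)) x

record Category o ℓ : Set (suc (o ⊔ ℓ)) where
  infix  4 _≈_
  infixr 9 _∘_
  field
    Obj      : Set o
    Hom      : Obj → Obj → Set ℓ
    _≈_      : ∀ {A B} → Rel (Hom A B) ℓ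
    id       : ∀ {A} → Hom A A
    _∘_      : ∀ {A B C} → Hom B C → Hom A B → Hom A C
    equiv    : ∀ {A B} → IsEquivalence (_≈_ {A} {B})
    ∘-resp-≈ : ∀ {A B C} {f h : Hom B C} {g i : Hom A B} →
               f ≈ h → g ≈ i → f ∘ g ≈ h ∘ i
    identityˡ : ∀ {A B} {f : Hom A B} → id ∘ f ≈ f
    identityʳ : ∀ {A B} {f : Hom A B} → f ∘ id ≈ f
    assoc     : ∀ {A B C D} {f : Hom A B} {g : Hom B C} {h : Hom C D} →
                (h ∘ g) ∘ f ≈ h ∘ (g ∘ f)

FullSubcategory : ∀ {o ℓ p} (𝒞 : Category o ℓ) →
                  Pred (Category.Obj 𝒞) p → Category (o ⊔ p) ℓ
FullSubcategory 𝒞 P = record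
  { Obj       = Σ Obj P
  ; Hom       = λ A B → Hom (proj₁ A) (proj₁ B)
  ; _≈_       = _≈_
  ; id        = id
  ; _∘_       = _∘_
  ; equiv     = equiv
  ; ∘-resp-≈  = ∘-resp-≈
  ; identityˡ = identityˡ
  ; identityʳ = identityʳ
  ; assoc     = assoc
  }
  where open Category 𝒞

module _ {o ℓ} (𝒞 : Category o ℓ) where
  open Category 𝒞

  record Terminal : Set (o ⊔ ℓ) where
    field
      ⊤        : Obj
      !        : ∀ {X} → Hom X ⊤
      !-unique : ∀ {X} (f : Hom X ⊤) → f ≈ !

  record Product (A B : Obj) : Set (o ⊔ ℓ) where
    field
      A×B      : Obj
      π₁       : Hom A×B A
      π₂       : Hom A×B B
      ⟨_,_⟩    : ∀ {X} → Hom X A → Hom X B → Hom X A×B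
      project₁ : ∀ {X} {f : Hom X A} {g : Hom X B} → π₁ ∘ ⟨ f , g ⟩ ≈ f
      project₂ : ∀ {X} {f : Hom X A} {g : Hom X B} → π₂ ∘ ⟨ f , g ⟩ ≈ g
      unique   : ∀ {X} {f : Hom X A} {g : Hom X B} (h : Hom X A×B) →
                 π₁ ∘ h ≈ f → π₂ ∘ h ≈ g → h ≈ ⟨ f , g ⟩

  -- h × id_A
  _×id[_,_] : ∀ {A X Y} → Hom X Y → (P : Product X A) (Q : Product Y A) →
              Hom (Product.A×B P) (Product.A×B Q)
  h ×id[ P , Q ] = Product.⟨_,_⟩ Q (h ∘ Product.π₁ P) (Product.π₂ P)

  record Exponential (product : ∀ A B → Product A B) (A B : Obj) :
                     Set (o ⊔ ℓ) where
    _×A : Obj → Obj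
    X ×A = Product.A×B (product X A)

    _×id : ∀ {X Y} → Hom X Y → Hom (X ×A) (Y ×A)
    _×id {X} {Y} h = h ×id[ product X A , product Y A ]

    field
      B^A    : Obj
      eval   : Hom (B^A ×A) B
      curry  : ∀ {X} → Hom (X ×A) B → Hom X B^A
      β      : ∀ {X} {g : Hom (X ×A) B} → eval ∘ (curry g ×id) ≈ g
      unique : ∀ {X} {g : Hom (X ×A) B} (h : Hom X B^A) →
               eval ∘ (h ×id) ≈ g → h ≈ curry g

  record CartesianClosed : Set (o ⊔ ℓ) where
    field
      terminal    : Terminal
      product     : ∀ A B → Product A B
      exponential : ∀ A B → Exponential product A B

idˢ : ∀ {ℓ} {D : Dcpo ℓ} → ScottMap D D
idˢ {D = D} = record
  { to       = λ x → x
  ; mono     = λ x≤y → x≤y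
  ; pres-sup = λ S dir s (ub , least) →
      (λ (i , i∈S , y≈i) → trans (reflexive y≈i) (ub i∈S)) ,
      (λ u u-ub → least u λ {x} x∈S → u-ub (x , x∈S , Eq.refl))
  }
  where open Dcpo D

module _ {ℓ} (em : ExcludedMiddle ℓ) where

  -- Testing Scott continuity on Boolean subsets loses nothing.
  pres-sup-pred : ∀ {D E : Dcpo ℓ} (f : ScottMap D E) →
    (A : Pred (Dcpo.Carrier D) ℓ) → IsDirected (Dcpo.poset D) A →
    ∀ s → IsSup (Dcpo.poset D) A s →
    IsSup (Dcpo.poset E) (Image (Dcpo.poset E) (to f) A) (to f s)
  pres-sup-pred {D} {E} f A ((a₀ , a₀∈A) , dir) s (ub , least) =
    let (S , S⇔A) = decideSubset em A
        out = λ {x} → Equivalence.to (S⇔A x)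
        inn = λ {x} → Equivalence.from (S⇔A x)
        (fub , fleast) = ScottMap.pres-sup f S
          ( (a₀ , inn a₀∈A)
          , λ x∈S y∈S → let (z , z∈A , x≤z , y≤z) = dir (out x∈S) (out y∈S)
                        in z , inn z∈A , x≤z , y≤z )
          s
          ((λ x∈S → ub (out x∈S)) , λ u u-ub → least u λ x∈A → u-ub (inn x∈A))
    in (λ (x , x∈A , y≈fx) → fub (x , inn x∈A , y≈fx)) ,
       (λ u u-ub → fleast u λ (x , x∈S , y≈fx) → u-ub (x , out x∈S , y≈fx))

  composeˢ : ∀ {D E F : Dcpo ℓ} → ScottMap E F → ScottMap D E → ScottMap D F
  composeˢ {D} {E} {F} g f = record
    { to       = λ x → to g (to f x)
    ; mono     = λ x≤y → ScottMap.mono g (ScottMap.mono f x≤y)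
    ; pres-sup = pres
    }
    where
    module D = Dcpo D
    module E = Dcpo E
    module F = Dcpo F
    pres : (S : Subset D.Carrier) → IsDirected D.poset ⟦ S ⟧ →
           ∀ s → IsSup D.poset ⟦ S ⟧ s →
           IsSup F.poset (Image F.poset (λ x → to g (to f x)) ⟦ S ⟧)
                         (to g (to f s))
    pres S S-dir@((x₀ , x₀∈S) , dir) s s-sup =
      let (ub , least) = pres-sup-pred g (Image E.poset (to f) ⟦ S ⟧)
            ( (_ , x₀ , x₀∈S , E.Eq.refl)
            , λ (x , x∈S , u≈fx) (y , y∈S , v≈fy) →
                let (z , z∈S , x≤z , y≤z) = dir x∈S y∈S
                in to f z , (z , z∈S , E.Eq.refl) ,
                   E.trans (E.reflexive u≈fx) (ScottMap.mono f x≤z) ,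
                   E.trans (E.reflexive v≈fy) (ScottMap.mono f y≤z) )
            (to f s) (ScottMap.pres-sup f S S-dir s s-sup)
      in (λ (x , x∈S , y≈gfx) →
            ub (to f x , (x , x∈S , E.Eq.refl) , y≈gfx)) ,
         (λ u u-ub → least u λ (v , (x , x∈S , v≈fx) , y≈gv) →
            u-ub (x , x∈S , F.Eq.trans y≈gv (ScottMap.cong g v≈fx)))

  DCPO : Category (suc ℓ) ℓ
  DCPO = record
    { Obj       = Dcpo ℓ
    ; Hom       = ScottMap
    ; _≈_       = λ {D} {E} → Poset._≈_ (scottPoset D E)
    ; id        = idˢ
    ; _∘_       = composeˢ
    ; equiv     = λ {D} {E} → Poset.isEquivalence (scottPoset D E)
    ; ∘-resp-≈  = λ {A} {B} {C} {f} {h} {g} {i} f≈h g≈i x →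
        Dcpo.Eq.trans C (f≈h (to g x)) (ScottMap.cong h (g≈i x))
    ; identityˡ = λ {A} {B} x → Dcpo.Eq.refl B
    ; identityʳ = λ {A} {B} x → Dcpo.Eq.refl B
    ; assoc     = λ {A} {B} {C} {D} x → Dcpo.Eq.refl D
    }

  𝓕-category : ∀ {c} → (Dcpo ℓ → Set c) → Category (suc ℓ ⊔ c) ℓ
  𝓕-category C = FullSubcategory DCPO (𝓕 C)

-- Write 𝓕ˢ(C) for the objects of 𝓕(C) whose approximating maps can be chosen
-- finitely separated from the identity.  For (2) ⇒ (1), products and function
-- spaces of objects of 𝓕(C) lie in 𝓕(𝓕(C)), so everything rests on
-- 𝓕(𝓕ˢ(C)) ⊆ 𝓕ˢ(C), together with C ⊆ 𝓕ˢ(C), where the countable bases enter.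
-- If aₙ = eₙ ∘ pₙ and fₙₖ ↑ id is the separated sequence of the n-th object,
-- then gₙₖ = eₙ ∘ fₙₖ ∘ pₙ is finitely separated, the elements gₙₖ(x) form a
-- directed family with supremum x, and hence every gₙₖ² lies below some
-- g_{jl}² with j, l as large as desired; a cofinal sequence of the squares
-- witnesses D ∈ 𝓕ˢ(C).
--
-- For (1) ⇒ (2), let R be the abstract product or exponential and E the concrete
-- one.  Points of R correspond to points of E, and if x ≤ y in E with x ≠ y,
-- then some X in the category has points u < v, and the two-valued Scott map
-- X → E with u ↦ x, v ↦ y lifts to R.  So R and E are order-isomorphic.

module Submission where

open import Axiom.ExcludedMiddle using (ExcludedMiddle)
open import Data.Empty using (⊥-elim)
open import Data.List.Base as List using (List; []; _∷_; upTo; cartesianProductWith)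
open import Data.List.Membership.Propositional.Properties
  using (∈-cartesianProductWith⁺; ∈-upTo⁺)
open import Data.List.Relation.Unary.All as All using (All; []; _∷_)
open import Data.List.Relation.Unary.Any as Any using ()
open import Data.List.Relation.Unary.Any.Properties using (map⁺)
open import Data.Nat.Base as ℕ using (ℕ; zero; suc)
import Data.Nat.Properties as ℕ
open import Data.Product.Base using (Σ; ∃; ∃₂; _×_; _,_; proj₁; proj₂)
open import Data.Unit.Polymorphic.Base using (⊤; tt)
open import Function.Base using (_∘_)
open import Function.Bundles using (Equivalence; Injection; _⇔_; mk⇔)
open import Level using (Level; _⊔_) renaming (suc to lsuc)
open import Relation.Binary.Bundles using (Poset)
open import Relation.Binary.Core using (Rel)
open import Relation.Binary.Definitions using (Reflexive; Transitive)
open import Relation.Binary.PropositionalEquality as ≡ using (_≡_)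
open import Relation.Nullary using (¬_; Dec; yes; no)
open import Relation.Unary using (Pred)
open import Defs

private variable
  a b r ℓ c : Level

-- Eventual properties of sequences and double sequences.

Eventually : Pred ℕ a → Set a
Eventually P = ∃ λ N → ∀ {n} → N ℕ.≤ n → P n

-- The threshold for the second index may depend on the first, as it does in `g-eventually`.
-- Finitely many such properties still have a common witness.
Eventually₂ : (ℕ → ℕ → Set a) → Set a
Eventually₂ P = Eventually λ m → Eventually (P m)

eventually-witness : {P : Pred ℕ a} → Eventually P → ∃ P
eventually-witness (N , P≥N) = N , P≥N ℕ.≤-refl

eventually-map : {P : Pred ℕ a} {Q : Pred ℕ b} → (∀ {n} → P n → Q n) →
                 Eventually P → Eventually Q
eventually-map f (N , P≥N) = N , λ N≤n → f (P≥N N≤n)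

eventually-zip : {P : Pred ℕ a} {Q : Pred ℕ b} {R : Pred ℕ r} →
                 (∀ {n} → P n → Q n → R n) →
                 Eventually P → Eventually Q → Eventually R
eventually-zip f (M , P≥M) (N , Q≥N) = M ℕ.⊔ N , λ M⊔N≤n →
  f (P≥M (ℕ.m⊔n≤o⇒m≤o M N M⊔N≤n)) (Q≥N (ℕ.m⊔n≤o⇒n≤o M N M⊔N≤n))

eventually₂-map : {P : ℕ → ℕ → Set a} {Q : ℕ → ℕ → Set b} →
                  (∀ {m n} → P m n → Q m n) →
                  Eventually₂ P → Eventually₂ Q
eventually₂-map f = eventually-map (eventually-map f)

eventually₂-zip : {P : ℕ → ℕ → Set a} {Q : ℕ → ℕ → Set b} {R : ℕ → ℕ → Set r} →
                  (∀ {m n} → P m n → Q m n → R m n) →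
                  Eventually₂ P → Eventually₂ Q → Eventually₂ R
eventually₂-zip f = eventually-zip (eventually-zip f)

eventually₂-witness : {P : ℕ → ℕ → Set a} → Eventually₂ P → ∃₂ P
eventually₂-witness P-ev =
  let (m , P-ev-m) = eventually-witness P-ev in m , eventually-witness P-ev-m

eventually₂-all : {X : Set b} {P : X → ℕ → ℕ → Set a} →
                  (∀ x → Eventually₂ (P x)) →
                  ∀ xs → Eventually₂ λ m n → All (λ x → P x m n) xs
eventually₂-all P-ev []       = 0 , λ _ → 0 , λ _ → []
eventually₂-all P-ev (x ∷ xs) =
  eventually₂-zip _∷_ (P-ev x) (eventually₂-all P-ev xs)

-- Cofinal sequences in directed preorders.

module _ {X : Set a} (_≼_ : Rel X r) (≼-refl : Reflexive _≼_)
         (≼-trans : Transitive _≼_)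
         (directed : ∀ x y → ∃ λ z → x ≼ z × y ≼ z) where

  upper-bound : ∀ x ys → ∃ λ z → x ≼ z × All (_≼ z) ys
  upper-bound x []       = x , ≼-refl , []
  upper-bound x (y ∷ ys) =
    let (w , x≼w , ys≼w) = upper-bound x ys
        (z , w≼z , y≼z)  = directed w y
    in z , ≼-trans x≼w w≼z , y≼z ∷ All.map (λ y≼w → ≼-trans y≼w w≼z) ys≼w

  -- The term after `σ n` bounds `σ n` and the finitely many `q i j` with i, j < n, so each step
  -- takes a finite upper bound and every `q i j` is reached.
  cofinal-sequence : (q : ℕ → ℕ → X) → ∃ λ (σ : ℕ → X) →
    (∀ n → σ n ≼ σ (suc n)) × (∀ i j → ∃ λ n → q i j ≼ σ n)
  cofinal-sequence q = σ , (λ n → proj₁ (proj₂ (next n))) , λ i j →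
    -- `upTo n` stops before n, so i and j are first covered by `next (suc (i ⊔ j))`, whose value is
    -- the term one later.
    suc (suc (i ℕ.⊔ j)) ,
    All.lookup (proj₂ (proj₂ (next (suc (i ℕ.⊔ j)))))
      (∈-cartesianProductWith⁺ q (∈-upTo⁺ (ℕ.s≤s (ℕ.m≤m⊔n i j)))
                                 (∈-upTo⁺ (ℕ.s≤s (ℕ.m≤n⊔m i j))))
    where
    σ : ℕ → X
    next : ∀ n → ∃ λ z → σ n ≼ z ×
                         All (_≼ z) (cartesianProductWith q (upTo n) (upTo n))
    σ zero    = q 0 0
    σ (suc n) = proj₁ (next n)
    next n = upper-bound (σ n) (cartesianProductWith q (upTo n) (upTo n))

-- Directed families and increasing chains.

module _ {c ℓ₁ ℓ₂} (P : Poset c ℓ₁ ℓ₂) where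
  open Poset P

  -- The first component witnesses that `I` is inhabited. With `I` in `Set`, the range of a family
  -- in a `Dcpo ℓ` is a predicate at level ℓ, which `em` can decide.
  IsDirectedFamily : {I : Set} → (I → Carrier) → Set ℓ₂
  IsDirectedFamily {I} x = I × (∀ i j → ∃ λ k → x i ≤ x k × x j ≤ x k)

  module _ {I : Set} {x : I → Carrier} where

    range-directed : IsDirectedFamily x → IsDirected P (Range P x)
    range-directed (i₀ , dir) = (x i₀ , i₀ , Eq.refl) ,
      λ (i , y≈xi) (j , z≈xj) →
        let (k , xi≤xk , xj≤xk) = dir i j
        in x k , (k , Eq.refl) ,
           trans (reflexive y≈xi) xi≤xk , trans (reflexive z≈xj) xj≤xk

    range-sup : ∀ {s} → (∀ i → x i ≤ s) → (∀ u → (∀ i → x i ≤ u) → s ≤ u) →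
                IsSup P (Range P x) s
    range-sup ub least =
      (λ (i , y≈xi) → trans (reflexive y≈xi) (ub i)) ,
      (λ u u-ub → least u λ i → u-ub (i , Eq.refl))

    range-ub : ∀ {s} → IsSup P (Range P x) s → ∀ i → x i ≤ s
    range-ub (ub , _) i = ub (i , Eq.refl)

    range-least : ∀ {s} → IsSup P (Range P x) s → ∀ u → (∀ i → x i ≤ u) → s ≤ u
    range-least (_ , least) u u-ub =
      least u λ (i , y≈xi) → trans (reflexive y≈xi) (u-ub i)

  module _ {x : ℕ → Carrier} (x-increasing : ∀ n → x n ≤ x (suc n)) where

    chain-mono : ∀ {m n} → m ℕ.≤ n → x m ≤ x n
    chain-mono = go ∘ ℕ.≤⇒≤′
      where
      go : ∀ {m n} → m ℕ.≤′ n → x m ≤ x n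
      go ℕ.≤′-refl       = refl
      go (ℕ.≤′-step m≤n) = trans (go m≤n) (x-increasing _)

    chain-directed : IsDirectedFamily x
    chain-directed = 0 , λ m n →
      m ℕ.⊔ n , chain-mono (ℕ.m≤m⊔n m n) , chain-mono (ℕ.m≤n⊔m m n)

-- Basic Scott maps, products and the one-point dcpo.

module _ {D E : Dcpo ℓ} where
  private
    module D = Dcpo D
    module E = Dcpo E

  image-directed : (f : ScottMap D E) {A : Pred D.Carrier a} →
    IsDirected D.poset A → IsDirected E.poset (Image E.poset (to f) A)
  image-directed f ((x₀ , x₀∈A) , dir) =
    (to f x₀ , x₀ , x₀∈A , E.Eq.refl) ,
    λ (x , x∈A , u≈fx) (y , y∈A , v≈fy) →
      let (z , z∈A , x≤z , y≤z) = dir x∈A y∈A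
      in to f z , (z , z∈A , E.Eq.refl) ,
         E.trans (E.reflexive u≈fx) (ScottMap.mono f x≤z) ,
         E.trans (E.reflexive v≈fy) (ScottMap.mono f y≤z)

  constˢ : E.Carrier → ScottMap D E
  constˢ y = record
    { to       = λ _ → y
    ; mono     = λ _ → E.refl
    ; pres-sup = λ S ((x₀ , x₀∈S) , _) s s-sup →
        (λ (_ , _ , z≈y) → E.reflexive z≈y) ,
        (λ u u-ub → u-ub (x₀ , x₀∈S , E.Eq.refl))
    }

  -- Suprema of a function space are pointwise because those chosen by
  -- `complete` are.
  pointwise-sup : (A : Pred (ScottMap D E) ℓ) → IsDirected (scottPoset D E) A →
    ∀ f → IsSup (scottPoset D E) A f →
    ∀ x → IsSup E.poset (Image E.poset (λ g → to g x) A) (to f x)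
  pointwise-sup A A-dir f (ub , least) x =
    (λ (g , g∈A , y≈gx) → E.trans (E.reflexive y≈gx) (ub g∈A x)) ,
    (λ u u-ub → E.trans
       (least (proj₁ A-sup) (proj₁ (proj₂ A-sup)) x)
       (proj₂ (proj₂ (E.complete _ _)) u u-ub))
    where
    A-sup = Dcpo.complete (D ⇒ᵈ E) A A-dir

module _ (A B : Dcpo ℓ) where
  private
    module A = Dcpo A
    module B = Dcpo B

  fstˢ : ScottMap (A ×ᵈ B) A
  fstˢ = record
    { to       = proj₁
    ; mono     = proj₁
    ; pres-sup = λ S dir (s , t) (ub , least) →
        (λ (_ , x∈S , z≈x) → A.trans (A.reflexive z≈x) (proj₁ (ub x∈S))) ,
        -- Pairing the competing bound `u` with the given supremum `t` makes an upper bound of `S`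
        -- in the product.
        (λ u u-ub → proj₁ (least (u , t) λ x∈S →
           u-ub (_ , x∈S , A.Eq.refl) , proj₂ (ub x∈S)))
    }

  sndˢ : ScottMap (A ×ᵈ B) B
  sndˢ = record
    { to       = proj₂
    ; mono     = proj₂
    ; pres-sup = λ S dir (s , t) (ub , least) →
        (λ (_ , x∈S , z≈x) → B.trans (B.reflexive z≈x) (proj₂ (ub x∈S))) ,
        (λ u u-ub → proj₂ (least (s , u) λ x∈S →
           proj₁ (ub x∈S) , u-ub (_ , x∈S , B.Eq.refl)))
    }

module _ {A B X : Dcpo ℓ} where
  private
    module A = Dcpo A
    module B = Dcpo B

  pairˢ : ScottMap X A → ScottMap X B → ScottMap X (A ×ᵈ B)
  pairˢ f g = record
    { to       = λ x → to f x , to g x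
    ; mono     = λ x≤y → ScottMap.mono f x≤y , ScottMap.mono g x≤y
    ; pres-sup = λ S dir s s-sup →
        let (f-ub , f-least) = ScottMap.pres-sup f S dir s s-sup
            (g-ub , g-least) = ScottMap.pres-sup g S dir s s-sup
        in (λ (x , x∈S , (y≈fx , z≈gx)) →
              f-ub (x , x∈S , y≈fx) , g-ub (x , x∈S , z≈gx)) ,
           (λ (u , v) uv-ub →
              f-least u (λ (x , x∈S , y≈fx) → A.trans (A.reflexive y≈fx)
                (proj₁ (uv-ub (x , x∈S , A.Eq.refl , B.Eq.refl)))) ,
              g-least v (λ (x , x∈S , y≈gx) → B.trans (B.reflexive y≈gx)
                (proj₂ (uv-ub (x , x∈S , A.Eq.refl , B.Eq.refl)))))
    }

𝟙 : Dcpo ℓ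
𝟙 = record
  { poset = record
    { Carrier = ⊤
    ; _≈_ = λ _ _ → ⊤
    ; _≤_ = λ _ _ → ⊤
    ; isPartialOrder = record
      { isPreorder = record
        { isEquivalence = record {}
        ; reflexive = λ _ → tt
        ; trans = λ _ _ → tt
        }
      ; antisym = λ _ _ → tt
      }
    }
  ; complete = λ _ _ → tt , (λ _ → tt) , (λ _ _ → tt)
  }

module Theory {ℓ} (em : ExcludedMiddle ℓ) where

  infixr 9 _∘ˢ_
  _∘ˢ_ : {D E F : Dcpo ℓ} → ScottMap E F → ScottMap D E → ScottMap D F
  _∘ˢ_ = composeˢ em

  -- Evaluation and currying.

  module _ (A B : Dcpo ℓ) where
    private
      module A = Dcpo A
      module B = Dcpo B

    -- Suprema are taken in the map first and then in the argument. The map `g′` and the argument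
    -- `w` come from different members of `S`; a common upper bound `(k , t)` in `S` puts g′ w below
    -- k t.
    evalˢ : ScottMap ((A ⇒ᵈ B) ×ᵈ A) B
    evalˢ = record
      { to       = λ (f , x) → to f x
      ; mono     = λ {(f , x)} {(g , y)} (f≤g , x≤y) →
          B.trans (f≤g x) (ScottMap.mono g x≤y)
      ; pres-sup = λ S S-dir (f , x) fx-sup →
          (λ ((g , y) , gy∈S , z≈gy) → B.trans (B.reflexive z≈gy)
             (B.trans (proj₁ (proj₁ fx-sup gy∈S) y)
                      (ScottMap.mono f (proj₂ (proj₁ fx-sup gy∈S))))) ,
          (λ u u-ub →
             let S₁-dir = image-directed (fstˢ (A ⇒ᵈ B) A) S-dir
                 S₂-dir = image-directed (sndˢ (A ⇒ᵈ B) A) S-dir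
                 S₁-sup = ScottMap.pres-sup (fstˢ (A ⇒ᵈ B) A) S S-dir (f , x) fx-sup
                 S₂-sup = ScottMap.pres-sup (sndˢ (A ⇒ᵈ B) A) S S-dir (f , x) fx-sup
             in proj₂ (pointwise-sup _ S₁-dir f S₁-sup x) u
                  λ (g , ((g′ , y) , gy∈S , g≈g′) , z≈gx) →
                B.trans (B.reflexive (B.Eq.trans z≈gx (g≈g′ x)))
                  (proj₂ (pres-sup-pred em g′ _ S₂-dir x S₂-sup) u
                     λ (v , ((h , w) , hw∈S , v≈w) , z≈gv) →
                   let ((k , t) , kt∈S , (g≤k , _) , (_ , w≤t)) =
                         proj₂ S-dir gy∈S hw∈S
                   in B.trans (B.reflexive (B.Eq.trans z≈gv (ScottMap.cong g′ v≈w)))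
                        (B.trans (g≤k w) (B.trans (ScottMap.mono k w≤t)
                          (u-ub ((k , t) , kt∈S , B.Eq.refl))))))
      }

    curryˢ : {X : Dcpo ℓ} → ScottMap (X ×ᵈ A) B → ScottMap X (A ⇒ᵈ B)
    curryˢ {X} g = record
      { to       = λ x → g ∘ˢ pairˢ (constˢ {E = X} x) (idˢ {D = A})
      ; mono     = λ x≤y z → ScottMap.mono g (x≤y , A.refl)
      ; pres-sup = λ S S-dir s s-sup →
          (λ (x , x∈S , h≈gx) z → B.trans (B.reflexive (h≈gx z))
             (ScottMap.mono g (proj₁ s-sup x∈S , A.refl))) ,
          (λ u u-ub z →
             proj₂ (ScottMap.pres-sup (g ∘ˢ pairˢ (idˢ {D = X}) (constˢ {E = A} z)) S S-dir s s-sup)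
               (to u z)
               λ (x , x∈S , y≈gxz) → B.trans (B.reflexive y≈gxz)
                 (u-ub {g ∘ˢ pairˢ (constˢ {E = X} x) (idˢ {D = A})}
                   (x , x∈S , λ _ → B.Eq.refl) z))
      }

  mapˢ : {A A′ B B′ : Dcpo ℓ} → ScottMap A A′ → ScottMap B B′ →
         ScottMap (A ×ᵈ B) (A′ ×ᵈ B′)
  mapˢ {A} {_} {B} f g = pairˢ (f ∘ˢ fstˢ A B) (g ∘ˢ sndˢ A B)

  homˢ : {A A′ B B′ : Dcpo ℓ} → ScottMap A′ A → ScottMap B B′ →
         ScottMap (A ⇒ᵈ B) (A′ ⇒ᵈ B′)
  homˢ {A} {A′} {B} {B′} f g =
    curryˢ A′ B′ (g ∘ˢ evalˢ A B ∘ˢ mapˢ (idˢ {D = A ⇒ᵈ B}) f)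

  -- Two-valued Scott maps.

  module _ (D E : Dcpo ℓ) where
    private
      module D = Dcpo D
      module E = Dcpo E

    -- Scott-continuous because ↓ d is Scott-closed.
    module _ (d : D.Carrier) {x y : E.Carrier} (x≤y : x E.≤ y) where
      private
        branch : ∀ {z} → Dec (z D.≤ d) → E.Carrier
        branch (yes _) = x
        branch (no _)  = y

        step : D.Carrier → E.Carrier
        step z = branch (em {z D.≤ d})

      step-≤ : ∀ {z} → z D.≤ d → step z ≡ x
      step-≤ {z} z≤d with em {z D.≤ d}
      ... | yes _   = ≡.refl
      ... | no  z≰d = ⊥-elim (z≰d z≤d)

      step-≰ : ∀ {z} → ¬ z D.≤ d → step z ≡ y
      step-≰ {z} z≰d with em {z D.≤ d}
      ... | yes z≤d = ⊥-elim (z≰d z≤d)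
      ... | no  _   = ≡.refl

      private
        step-lower : ∀ z → x E.≤ step z
        step-lower z with em {z D.≤ d}
        ... | yes _ = E.refl
        ... | no  _ = x≤y

        step-mono : ∀ {z w} → z D.≤ w → step z E.≤ step w
        step-mono {z} {w} z≤w with em {z D.≤ d}
        ... | yes _   = step-lower w
        ... | no  z≰d = E.reflexive (E.Eq.reflexive
                (≡.sym (step-≰ λ w≤d → z≰d (D.trans z≤w w≤d))))

        step-least : (S : Subset D.Carrier) → IsDirected D.poset ⟦ S ⟧ →
                     ∀ s → IsSup D.poset ⟦ S ⟧ s →
                     ∀ u → (∀ {z} → ⟦ S ⟧ z → step z E.≤ u) → step s E.≤ u
        step-least S ((z₀ , z₀∈S) , _) s s-sup u u-ub
          with em {s D.≤ d} | em {∃ λ z → ⟦ S ⟧ z × ¬ z D.≤ d}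
        ... | yes _ | _ = E.trans (step-lower z₀) (u-ub z₀∈S)
        ... | no _  | yes (z , z∈S , z≰d) = E.trans
                (E.reflexive (E.Eq.reflexive (≡.sym (step-≰ z≰d)))) (u-ub z∈S)
        ... | no s≰d | no S≰d = ⊥-elim (s≰d (proj₂ s-sup d below))
          where
          below : ∀ {z} → ⟦ S ⟧ z → z D.≤ d
          below {z} z∈S with em {z D.≤ d}
          ... | yes z≤d = z≤d
          ... | no  z≰d = ⊥-elim (S≰d (z , z∈S , z≰d))

      stepˢ : ScottMap D E
      stepˢ = record
        { to       = step
        ; mono     = step-mono
        ; pres-sup = λ S S-dir s s-sup →
            (λ (z , z∈S , w≈) → E.trans (E.reflexive w≈)
               (step-mono (proj₁ s-sup z∈S))) ,
            (λ u u-ub → step-least S S-dir s s-sup u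
               λ {z} z∈S → u-ub (z , z∈S , E.Eq.refl))
        }

  -- Way-below, finite separation and interpolation.

  module _ {D E : Dcpo ℓ} where
    private
      module D = Dcpo D
      module E = Dcpo E

    scott-range : {I : Set} {x : I → D.Carrier} (f : ScottMap D E) →
      IsDirectedFamily D.poset x → ∀ {s} → IsSup D.poset (Range D.poset x) s →
      IsSup E.poset (Range E.poset (λ i → to f (x i))) (to f s)
    scott-range f dir {s} x-sup =
      range-sup E.poset
        (λ i → ScottMap.mono f (range-ub D.poset x-sup i))
        λ u u-ub → proj₂ (pres-sup-pred em f _ (range-directed D.poset dir) s x-sup)
          u λ (y , (i , y≈xi) , z≈fy) → E.trans
              (E.reflexive (E.Eq.trans z≈fy (ScottMap.cong f y≈xi))) (u-ub i)

  module _ (D : Dcpo ℓ) where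
    open Dcpo D

    -- `WayBelow` tests Boolean subsets, so `em` first decides the range; the member found there
    -- yields an index up to ≈.
    ≪-range : {I : Set} {x : I → Carrier} → IsDirectedFamily poset x →
              ∀ {y b s} → IsSup poset (Range poset x) s →
              WayBelow D y b → b ≤ s → ∃ λ i → y ≤ x i
    ≪-range {x = x} (i₀ , dir) {s = s} x-sup y≪b b≤s =
      let (S , S⇔) = decideSubset em (Range poset x)
          out = λ {z} → Equivalence.to (S⇔ z)
          inn = λ {z} → Equivalence.from (S⇔ z)
          ((_ , x₀∈R) , R-dir) = range-directed poset (i₀ , dir)
          (z , z∈S , y≤z) = y≪b S
            ( (_ , inn x₀∈R)
            , λ u∈S v∈S → let (w , w∈R , u≤w , v≤w) = R-dir (out u∈S) (out v∈S)
                          in w , inn w∈R , u≤w , v≤w )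
            s
            ( (λ u∈S → proj₁ x-sup (out u∈S))
            , λ u u-ub → proj₂ x-sup u (λ w∈R → u-ub (inn w∈R)) )
            b≤s
          (i , z≈xi) = out z∈S
      in i , trans y≤z (reflexive z≈xi)

    ≤-≪-trans : ∀ {x y z} → x ≤ y → WayBelow D y z → WayBelow D x z
    ≤-≪-trans x≤y y≪z E E-dir s s-sup z≤s =
      let (e , e∈E , y≤e) = y≪z E E-dir s s-sup z≤s in e , e∈E , trans x≤y y≤e

    separated-deflationary : ∀ f → FinitelySeparated D f → ∀ x → to f x ≤ x
    separated-deflationary f (M , sep) x =
      let (_ , fx≤m , m≤x) = Any.satisfied (sep x) in trans fx≤m m≤x

    -- Some e₀ ∈ E is above every separating element that is below a member
    -- of E, hence above f[E].
    separated-≪ : ∀ f → FinitelySeparated D f → ∀ x → WayBelow D (to f x) x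
    separated-≪ f (M , sep) x E E-dir@((e₁ , e₁∈E) , dir) s s-sup x≤s =
      let (e₀ , e₀∈E , M≤e₀) = absorb M
      in e₀ , e₀∈E , trans (ScottMap.mono f x≤s)
           (proj₂ (ScottMap.pres-sup f E E-dir s s-sup) e₀ λ (e , e∈E , y≈fe) →
             let (m≤e₀ , fe≤m , m≤e) = All.lookupAny M≤e₀ (sep e)
             in trans (reflexive y≈fe) (trans fe≤m (m≤e₀ (e , e∈E , m≤e))))
      where
      Below : Pred Carrier ℓ
      Below m = ∃ λ e → ⟦ E ⟧ e × m ≤ e
      absorb : ∀ ms → ∃ λ e → ⟦ E ⟧ e × All (λ m → Below m → m ≤ e) ms
      absorb [] = e₁ , e₁∈E , []
      absorb (m ∷ ms) with absorb ms | em {Below m}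
      ... | e , e∈E , ms≤e | no m≰E = e , e∈E , (λ m≤E → ⊥-elim (m≰E m≤E)) ∷ ms≤e
      ... | e , e∈E , ms≤e | yes (e′ , e′∈E , m≤e′) =
        let (d , d∈E , e≤d , e′≤d) = dir e∈E e′∈E
        in d , d∈E , (λ _ → trans m≤e′ e′≤d) ∷
             All.map (λ m≤e m≤E → trans (m≤e m≤E) e≤d) ms≤e

    -- Directedness is pointwise: the dominating index may vary with x, which is the form that
    -- `g-approximates` provides.
    Approximates : {I : Set} → (I → ScottMap D D) → Set ℓ
    Approximates F = ∀ x →
      IsDirectedFamily poset (λ i → to (F i) x) ×
      IsSup poset (Range poset (λ i → to (F i) x)) x

    -- The composites F i (F j x) are again directed with supremum x, so y ≪ x puts y below one of
    -- them.
    ≪-interpolate : {I : Set} (F : I → ScottMap D D) → Approximates F →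
      ∀ {x y} → WayBelow D y x → ∃₂ λ i j → y ≤ to (F i) (to (F j) x)
    ≪-interpolate {I} F approx {x} y≪x =
      let ((i , j) , y≤) = ≪-range FF-dir FF-sup y≪x refl in i , j , y≤
      where
      FF : I × I → Carrier
      FF (i , j) = to (F i) (to (F j) x)

      FF-dir : IsDirectedFamily poset FF
      FF-dir = (proj₁ (proj₁ (approx x)) , proj₁ (proj₁ (approx x))) ,
        λ (i , j) (i′ , j′) →
          -- The inner index is settled first, because the outer indices have to be compared at the
          -- point F k x.
          let (k , j≤k , j′≤k) = proj₂ (proj₁ (approx x)) j j′
              (h , i≤h , i′≤h) = proj₂ (proj₁ (approx (to (F k) x))) i i′
          in (h , k) , trans (ScottMap.mono (F i) j≤k) i≤h ,
                       trans (ScottMap.mono (F i′) j′≤k) i′≤h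

      FF-sup : IsSup poset (Range poset FF) x
      FF-sup = range-sup poset
        (λ (i , j) → trans (range-ub poset (proj₂ (approx (to (F j) x))) i)
                           (range-ub poset (proj₂ (approx x)) j))
        λ u u-ub → range-least poset (proj₂ (approx x)) u λ j →
          range-least poset (proj₂ (approx (to (F j) x))) u λ i → u-ub (i , j)

  -- Retracts and separated sequences.

  module _ {c} (C : Dcpo ℓ → Set c) where

    𝓕ˢ : Dcpo ℓ → Set (lsuc ℓ ⊔ c)
    𝓕ˢ D = ∃ λ (𝒟 : 𝓕 C D) →
      ∀ n → FinitelySeparated D (𝓕.e 𝒟 n ∘ˢ 𝓕.p 𝒟 n)

    C⊆𝓕 : ∀ {D} → C D → 𝓕 C D
    C⊆𝓕 {D} D∈C = record
      { obj          = λ _ → D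
      ; obj∈C        = λ _ → D∈C
      ; p            = λ _ → idˢ
      ; e            = λ _ → idˢ
      ; a-increasing = λ _ _ → D.refl
      ; a≤id         = λ _ _ → D.refl
      ; sup-a        = λ x → range-sup D.poset (λ _ → D.refl) λ u u-ub → u-ub 0
      }
      where module D = Dcpo D

    -- Carries membership from an abstract product or exponential to the concrete one. The maps r aₙ
    -- s increase to r s by continuity of r, and r s is the identity.
    𝓕-retract : ∀ {D E} (r : ScottMap D E) (s : ScottMap E D) →
                (∀ x → Dcpo._≈_ E (to r (to s x)) x) → 𝓕 C D → 𝓕 C E
    𝓕-retract {D} {E} r s rs≈id 𝒟 = record
      { obj          = 𝒟.obj
      ; obj∈C        = 𝒟.obj∈C
      ; p            = λ n → 𝒟.p n ∘ˢ s
      ; e            = λ n → r ∘ˢ 𝒟.e n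
      ; a-increasing = λ n x → ScottMap.mono r (𝒟.a-increasing n (to s x))
      ; a≤id         = λ n x → E.trans (ScottMap.mono r (𝒟.a≤id n (to s x)))
                                       (E.reflexive (rs≈id x))
      ; sup-a        = λ x → range-sup E.poset
          (λ n → E.trans (ScottMap.mono r (𝒟.a≤id n (to s x)))
                         (E.reflexive (rs≈id x)))
          λ u u-ub → E.trans (E.reflexive (E.Eq.sym (rs≈id x)))
            (range-least E.poset
              (scott-range r (chain-directed D.poset λ n → 𝒟.a-increasing n (to s x))
                             (𝒟.sup-a (to s x)))
              u u-ub)
      }
      where
      module 𝒟 = 𝓕 𝒟
      module D = Dcpo D
      module E = Dcpo E

    -- FS-domains need not come with a sequence; a countable base B provides one:
    -- for every pair b , b′ ∈ B with b ≤ f b′ for some f in the given family,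
    -- one such f suffices.
    C⊆𝓕ˢ : ∀ {D} → C D → CountablyBased D → IsFSDomain D → 𝓕ˢ D
    C⊆𝓕ˢ {D} D∈C (B , B-countable , B-base) (F , (F-inh , F-dir) , F-sep , F-sup) =
      record
      { obj          = λ _ → D
      ; obj∈C        = λ _ → D∈C
      ; p            = λ n → proj₁ (s n)
      ; e            = λ _ → idˢ
      ; a-increasing = s-increasing
      ; a≤id         = s≤id
      ; sup-a        = λ x → range-sup poset (λ n → s≤id n x) (s-least x)
      } , λ n → F-sep (proj₂ (s n))
      where
      open Dcpo D
      code : Σ Carrier B → ℕ
      code = Injection.to B-countable

      Good : ℕ → ℕ → Pred (ScottMap D D) ℓ
      Good i j f = Σ (Σ Carrier B) λ b → Σ (Σ Carrier B) λ b′ →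
        code b ≡ i × code b′ ≡ j × proj₁ b ≤ to f (proj₁ b′)

      choose : ∀ i j → Dec (∃ λ f → F f × Good i j f) → ∃ F
      choose i j (yes (f , f∈F , _)) = f , f∈F
      -- Index pairs for which no suitable map exists receive an arbitrary member of `F` as a
      -- default.
      choose i j (no _)              = F-inh

      q : ℕ → ℕ → ∃ F
      q i j = choose i j em

      -- The chosen map was selected for some d, d′ with the same codes as b, b′. Injectivity of the
      -- coding identifies them up to ≈.
      q-good : ∀ {f} → F f → ∀ b b′ → proj₁ b ≤ to f (proj₁ b′) →
               proj₁ b ≤ to (proj₁ (q (code b) (code b′))) (proj₁ b′)
      q-good {f} f∈F b b′ b≤fb′
        with em {∃ λ g → F g × Good (code b) (code b′) g}
      ... | no  none = ⊥-elim (none (f , f∈F , b , b′ , ≡.refl , ≡.refl , b≤fb′))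
      ... | yes (g , _ , d , d′ , d≡b , d′≡b′ , d≤gd′) =
        trans (reflexive (Eq.sym (Injection.injective B-countable d≡b)))
          (trans d≤gd′
            (ScottMap.mono g (reflexive (Injection.injective B-countable d′≡b′))))

      cofinal = cofinal-sequence {X = ∃ F}
        (λ f g → Poset._≤_ (scottPoset D D) (proj₁ f) (proj₁ g))
        (λ _ → refl)
        (λ f≤g g≤h x → trans (f≤g x) (g≤h x))
        (λ (f , f∈F) (g , g∈F) →
          let (h , h∈F , f≤h , g≤h) = F-dir f∈F g∈F in (h , h∈F) , f≤h , g≤h)
        q

      s = proj₁ cofinal
      s-increasing = proj₁ (proj₂ cofinal)

      s≤id : ∀ n x → to (proj₁ (s n)) x ≤ x
      s≤id n = separated-deflationary D (proj₁ (s n)) (F-sep (proj₂ (s n)))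

      -- Three suprema are unfolded: x over the f x, f x over the f b′ with b′ ≪ x, and f b′ over
      -- the b ≪ f b′. Each such b lies below some sₙ b′, hence below sₙ x.
      s-least : ∀ x u → (∀ n → to (proj₁ (s n)) x ≤ u) → x ≤ u
      s-least x u u-ub =
        proj₂ (F-sup x) u λ (f , f∈F , y≈fx) → trans (reflexive y≈fx)
          (proj₂ (pres-sup-pred em f _ (proj₁ (B-base x)) x (proj₂ (B-base x))) u
            λ (b′ , (b′∈B , b′≪x) , z≈fb′) → trans (reflexive z≈fb′)
              (proj₂ (proj₂ (B-base (to f b′))) u
                λ {b} (b∈B , b≪fb′) →
                  let b≤fb′ = proj₁ (proj₂ (B-base (to f b′))) (b∈B , b≪fb′)
                      b′≤x  = proj₁ (proj₂ (B-base x)) (b′∈B , b′≪x)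
                      (n , q≤sn) = proj₂ (proj₂ cofinal)
                                     (code (b , b∈B)) (code (b′ , b′∈B))
                  in trans (q-good f∈F (b , b∈B) (b′ , b′∈B) b≤fb′)
                       (trans (q≤sn b′)
                         (trans (ScottMap.mono (proj₁ (s n)) b′≤x) (u-ub n)))))

  𝓕-map : ∀ {c c′} {C : Dcpo ℓ → Set c} {C′ : Dcpo ℓ → Set c′} →
          (∀ {D} → C D → C′ D) → ∀ {D} → 𝓕 C D → 𝓕 C′ D
  𝓕-map C⊆C′ 𝒟 = record
    { obj          = 𝓕.obj 𝒟
    ; obj∈C        = λ n → C⊆C′ (𝓕.obj∈C 𝒟 n)
    ; p            = 𝓕.p 𝒟
    ; e            = 𝓕.e 𝒟
    ; a-increasing = 𝓕.a-increasing 𝒟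
    ; a≤id         = 𝓕.a≤id 𝒟
    ; sup-a        = 𝓕.sup-a 𝒟
    }

  -- Flattening a sequence of separated sequences.

  module _ {c} {C : Dcpo ℓ → Set c} {D : Dcpo ℓ} (𝒟 : 𝓕 (𝓕ˢ C) D) where
    open Dcpo D
    private
      module 𝒟 = 𝓕 𝒟
      module O n = Dcpo (𝒟.obj n)
      module ℱ n = 𝓕 (proj₁ (𝒟.obj∈C n))

      f : ∀ n → ℕ → ScottMap (𝒟.obj n) (𝒟.obj n)
      f n k = ℱ.e n k ∘ˢ ℱ.p n k

      f-approximates : ∀ n → Approximates (𝒟.obj n) (f n)
      f-approximates n y =
        chain-directed (O.poset n) (λ k → ℱ.a-increasing n k y) , ℱ.sup-a n y

      f-≪ : ∀ n k y → WayBelow (𝒟.obj n) (to (f n k) y) y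
      f-≪ n k = separated-≪ (𝒟.obj n) (f n k) (proj₂ (𝒟.obj∈C n) k)

      g : ℕ → ℕ → ScottMap D D
      g n k = 𝒟.e n ∘ˢ f n k ∘ˢ 𝒟.p n

      -- Squaring turns directedness at each point into directedness of the maps: the first
      -- application passes to one of finitely many separating elements.
      g² : ℕ → ℕ → ScottMap D D
      g² n k = g n k ∘ˢ g n k

      g-increasing : ∀ n x k → to (g n k) x ≤ to (g n (suc k)) x
      g-increasing n x k =
        ScottMap.mono (𝒟.e n) (ℱ.a-increasing n k (to (𝒟.p n) x))

      g-sup : ∀ n x → IsSup poset (Range poset (λ k → to (g n k) x)) (𝒟.a n x)
      g-sup n x = scott-range (𝒟.e n)
        (chain-directed (O.poset n) (λ k → ℱ.a-increasing n k (to (𝒟.p n) x)))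
        (ℱ.sup-a n (to (𝒟.p n) x))

      -- Applying eₙ to f (p x) ≤ m ≤ p x gives g x ≤ eₙ m ≤ aₙ x ≤ x, so the images of the
      -- separating elements separate g.
      g-separated : ∀ n k → FinitelySeparated D (g n k)
      g-separated n k =
        let (M , sep) = proj₂ (𝒟.obj∈C n) k
        in List.map (to (𝒟.e n)) M , λ x → map⁺ (Any.map
             (λ (fpx≤m , m≤px) → ScottMap.mono (𝒟.e n) fpx≤m ,
                trans (ScottMap.mono (𝒟.e n) m≤px) (𝒟.a≤id n x))
             (sep (to (𝒟.p n) x)))

      g-≪ : ∀ n k x → WayBelow D (to (g n k) x) x
      g-≪ n k = separated-≪ D (g n k) (g-separated n k)

      g≤id : ∀ n k x → to (g n k) x ≤ x
      g≤id n k = separated-deflationary D (g n k) (g-separated n k)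

      -- Interpolating in the n-th object gives g n k x ≤ g n i (aⱼ x) for large j,
      -- and g n i (aⱼ x) ≪ aⱼ x is the supremum of the g j l x.
      g-eventually : ∀ n k x → Eventually₂ λ j l → to (g n k) x ≤ to (g j l) x
      g-eventually n k x =
        let (i , i′ , fy≤ffy) = ≪-interpolate (𝒟.obj n) (f n) (f-approximates n)
              (f-≪ n k (to (𝒟.p n) x))
            (N , fy≤paₙ) = ≪-range (𝒟.obj n)
              (chain-directed (O.poset n) pa-increasing)
              (scott-range (𝒟.p n)
                (chain-directed poset λ m → 𝒟.a-increasing m x) (𝒟.sup-a x))
              (f-≪ n i′ (to (𝒟.p n) x)) (O.refl n)
        in N , λ {j} N≤j →
          let gx≤ga = ScottMap.mono (𝒟.e n) (O.trans n fy≤ffy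
                (ScottMap.mono (f n i)
                  (O.trans n fy≤paₙ (chain-mono (O.poset n) pa-increasing N≤j))))
              (l₀ , gx≤gl₀) = ≪-range D
                (chain-directed poset (g-increasing j x)) (g-sup j x)
                (≤-≪-trans D gx≤ga (g-≪ n i (𝒟.a j x))) refl
          in l₀ , λ l₀≤l → trans gx≤gl₀ (chain-mono poset (g-increasing j x) l₀≤l)
        where
        pa-increasing : ∀ m →
          O._≤_ n (to (𝒟.p n) (𝒟.a m x)) (to (𝒟.p n) (𝒟.a (suc m) x))
        pa-increasing m = ScottMap.mono (𝒟.p n) (𝒟.a-increasing m x)

      g-approximates : Approximates D (λ (n , k) → g n k)
      g-approximates x =
        ((0 , 0) , λ (n , k) (n′ , k′) →
          let (j , l , ≤jl , ≤′jl) = eventually₂-witness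
                (eventually₂-zip _,_ (g-eventually n k x) (g-eventually n′ k′ x))
          in (j , l) , ≤jl , ≤′jl) ,
        range-sup poset (λ (n , k) → g≤id n k x) λ u u-ub →
          range-least poset (𝒟.sup-a x) u λ n →
            range-least poset (g-sup n x) u λ k → u-ub (n , k)

      -- Since each factor is dominated eventually, one pair (j , l) serves both, and the bound is a
      -- square.
      gg-eventually : ∀ n k n′ k′ x →
        Eventually₂ λ j l → to (g n k) (to (g n′ k′) x) ≤ to (g² j l) x
      gg-eventually n k n′ k′ x = eventually₂-zip
        (λ {j} {l} outer inner → trans outer (ScottMap.mono (g j l) inner))
        (g-eventually n k (to (g n′ k′) x)) (g-eventually n′ k′ x)

      abstract
        -- As g n k x ≪ x, interpolation places it below a composite of two maps of the family, to
        -- which `gg-eventually` applies.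
        g≤g²-eventually : ∀ n k x → Eventually₂ λ j l → to (g n k) x ≤ to (g² j l) x
        g≤g²-eventually n k x =
          let ((i , i′) , (h , h′) , gx≤ggx) =
                ≪-interpolate D (λ (n , k) → g n k) g-approximates (g-≪ n k x)
          in eventually₂-map (trans gx≤ggx) (gg-eventually i i′ h h′ x)

      _≼_ : Rel (ℕ × ℕ) ℓ
      (n , k) ≼ (j , l) = ∀ x → to (g² n k) x ≤ to (g² j l) x

      -- By g n k (g n k x) ≤ g n k m ≤ g² j l m ≤ g² j l x it suffices to look
      -- at the finitely many separating elements m.
      ≼-eventually : ∀ n k → Eventually₂ λ j l → (n , k) ≼ (j , l)
      ≼-eventually n k =
        let (M , sep) = g-separated n k
        in eventually₂-map
             (λ {j} {l} gm≤g²m x →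
               let (gm≤ , gx≤m , m≤x) = All.lookupAny gm≤g²m (sep x)
               in trans (ScottMap.mono (g n k) gx≤m)
                    (trans gm≤ (ScottMap.mono (g² j l) m≤x)))
             (eventually₂-all (g≤g²-eventually n k) M)

      abstract
        cofinal : ∃ λ (σ : ℕ → ℕ × ℕ) →
          (∀ n → σ n ≼ σ (suc n)) × (∀ i j → ∃ λ n → (i , j) ≼ σ n)
        cofinal = cofinal-sequence _≼_ (λ _ → refl)
          (λ {i} {j} {k} i≼j j≼k x → trans (i≼j x) (j≼k x))
          (λ (n , k) (n′ , k′) →
            let (j , l , ≼jl , ≼′jl) = eventually₂-witness
                  (eventually₂-zip _,_ (≼-eventually n k) (≼-eventually n′ k′))
            in (j , l) , ≼jl , ≼′jl)
          _,_

      σ : ℕ → ℕ × ℕ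
      σ = proj₁ cofinal

      s : ℕ → ScottMap D D
      s i = let (n , k) = σ i in g² n k

      g²≤id : ∀ n k x → to (g² n k) x ≤ x
      g²≤id n k x = trans (g≤id n k (to (g n k) x)) (g≤id n k x)

      s-least : ∀ x u → (∀ i → to (s i) x ≤ u) → x ≤ u
      s-least x u u-ub =
        range-least poset (proj₂ (g-approximates x)) u λ (n , k) →
          let (j , l , gx≤g²x) = eventually₂-witness (g≤g²-eventually n k x)
              (i , ≼σi)        = proj₂ (proj₂ cofinal) j l
          in trans gx≤g²x (trans (≼σi x) (u-ub i))

    𝓕𝓕ˢ⊆𝓕ˢ : 𝓕ˢ C D
    𝓕𝓕ˢ⊆𝓕ˢ = record
      { obj          = λ i → let (n , k) = σ i in ℱ.obj n k
      ; obj∈C        = λ i → let (n , k) = σ i in ℱ.obj∈C n k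
      -- The extra factor g n k in the projection makes the composite g² while it still factors
      -- through an object of C.
      ; p            = λ i → let (n , k) = σ i in ℱ.p n k ∘ˢ 𝒟.p n ∘ˢ g n k
      ; e            = λ i → let (n , k) = σ i in 𝒟.e n ∘ˢ ℱ.e n k
      ; a-increasing = proj₁ (proj₂ cofinal)
      ; a≤id         = λ i → let (n , k) = σ i in g²≤id n k
      ; sup-a        = λ x → range-sup poset
          (λ i → let (n , k) = σ i in g²≤id n k x) (s-least x)
      } , λ i →
        let (n , k)   = σ i
            (M , sep) = g-separated n k
        -- The separating set of g also works for the square, since g² ≤ g.
        in M , λ x → Any.map
             (λ (gx≤m , m≤x) → trans (g≤id n k (to (g n k) x)) gx≤m , m≤x) (sep x)

  module _ {c} {C : Dcpo ℓ → Set c}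
           (C-separated : ∀ {D} → C D → 𝓕ˢ C D) where

    -- The flattening is applied twice: to each object of the given sequence, making it an object of
    -- `𝓕ˢ C`, and then to `D`.
    𝓕𝓕⊆𝓕 : ∀ {D} → 𝓕 (𝓕 C) D → 𝓕 C D
    𝓕𝓕⊆𝓕 𝒟 = proj₁ (𝓕𝓕ˢ⊆𝓕ˢ (𝓕-map (λ ℰ → 𝓕𝓕ˢ⊆𝓕ˢ (𝓕-map C-separated ℰ)) 𝒟))

  -- Approximating products and function spaces.

  module _ {c} {C : Dcpo ℓ → Set c} where

    𝓕-𝟙 : ∀ {D} → C D → Dcpo.Carrier D → 𝓕 C 𝟙
    𝓕-𝟙 {D} D∈C x = record
      { obj          = λ _ → D
      ; obj∈C        = λ _ → D∈C
      ; p            = λ _ → constˢ x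
      ; e            = λ _ → constˢ tt
      ; a-increasing = λ _ _ → tt
      ; a≤id         = λ _ _ → tt
      ; sup-a        = λ _ → (λ _ → tt) , (λ _ _ → tt)
      }

    module _ {D E : Dcpo ℓ} (𝒟 : 𝓕 C D) (ℰ : 𝓕 C E) where
      private
        module 𝒟 = 𝓕 𝒟
        module ℰ = 𝓕 ℰ
        module D = Dcpo D
        module E = Dcpo E

      𝓕-× : (∀ m n → 𝓕 C (𝒟.obj m ×ᵈ ℰ.obj n)) → 𝓕 (𝓕 C) (D ×ᵈ E)
      𝓕-× obj× = record
        { obj          = λ n → 𝒟.obj n ×ᵈ ℰ.obj n
        ; obj∈C        = λ n → obj× n n
        ; p            = λ n → mapˢ (𝒟.p n) (ℰ.p n)
        ; e            = λ n → mapˢ (𝒟.e n) (ℰ.e n)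
        ; a-increasing = λ n (x , y) → 𝒟.a-increasing n x , ℰ.a-increasing n y
        ; a≤id         = λ n (x , y) → 𝒟.a≤id n x , ℰ.a≤id n y
        ; sup-a        = λ (x , y) → range-sup (Dcpo.poset (D ×ᵈ E))
            (λ n → 𝒟.a≤id n x , ℰ.a≤id n y)
            λ (u , v) uv-ub →
              range-least D.poset (𝒟.sup-a x) u (λ n → proj₁ (uv-ub n)) ,
              range-least E.poset (ℰ.sup-a y) v (λ n → proj₂ (uv-ub n))
        }

      -- The n-th map sends φ to bₙ φ aₙ, for aₙ on D and bₙ on E. Its supremum is computed in two
      -- stages, over the aₘ inside φ and then over the bₙ outside.
      𝓕-⇒ : (∀ m n → 𝓕 C (𝒟.obj m ⇒ᵈ ℰ.obj n)) → 𝓕 (𝓕 C) (D ⇒ᵈ E)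
      𝓕-⇒ obj⇒ = record
        { obj          = λ n → 𝒟.obj n ⇒ᵈ ℰ.obj n
        ; obj∈C        = λ n → obj⇒ n n
        ; p            = hom-p
        ; e            = hom-e
        ; a-increasing = λ n φ x → E.trans
            (ℰ.a-increasing n (to φ (𝒟.a n x)))
            (aφ-mono (suc n) φ (𝒟.a-increasing n x))
        ; a≤id         = aφa≤φ
        ; sup-a        = λ φ → range-sup (scottPoset D E)
            {x = λ n → to (hom-e n) (to (hom-p n) φ)} {s = φ} (λ n → aφa≤φ n φ)
            λ u u-ub x → range-least E.poset
              (scott-range φ (chain-directed D.poset λ n → 𝒟.a-increasing n x)
                             (𝒟.sup-a x))
              (to u x)
              λ m → range-least E.poset (ℰ.sup-a (to φ (𝒟.a m x))) (to u x)
                λ n → E.trans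
                  -- The independent indices m and n are both raised to m ⊔ n, where one
                  -- approximating map bounds the value.
                  (chain-mono E.poset
                    (λ n → ℰ.a-increasing n (to φ (𝒟.a m x))) (ℕ.m≤n⊔m m n))
                  (E.trans
                    (aφ-mono (m ℕ.⊔ n) φ
                      (chain-mono D.poset (λ n → 𝒟.a-increasing n x) (ℕ.m≤m⊔n m n)))
                    (u-ub (m ℕ.⊔ n) x))
        }
        where
        hom-p : ∀ n → ScottMap (D ⇒ᵈ E) (𝒟.obj n ⇒ᵈ ℰ.obj n)
        hom-p n = homˢ (𝒟.e n) (ℰ.p n)

        hom-e : ∀ n → ScottMap (𝒟.obj n ⇒ᵈ ℰ.obj n) (D ⇒ᵈ E)
        hom-e n = homˢ (𝒟.p n) (ℰ.e n)

        aφ-mono : ∀ n φ {x y} → x D.≤ y → ℰ.a n (to φ x) E.≤ ℰ.a n (to φ y)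
        aφ-mono n φ x≤y = ScottMap.mono (ℰ.e n ∘ˢ ℰ.p n ∘ˢ φ) x≤y

        aφa≤φ : ∀ n (φ : ScottMap D E) x → ℰ.a n (to φ (𝒟.a n x)) E.≤ to φ x
        aφa≤φ n φ x = E.trans (ℰ.a≤id n _) (ScottMap.mono φ (𝒟.a≤id n x))

  -- Cartesian closed full subcategories and representing objects.

  full-ccc : ∀ {k} (K : Pred (Dcpo ℓ) k) → K 𝟙 →
             (∀ {D E} → K D → K E → K (D ×ᵈ E)) →
             (∀ {D E} → K D → K E → K (D ⇒ᵈ E)) →
             CartesianClosed (FullSubcategory (DCPO em) K)
  full-ccc K K-𝟙 K-× K-⇒ = record
    { terminal = record
      { ⊤        = 𝟙 , K-𝟙
      ; !        = constˢ tt
      ; !-unique = λ _ _ → tt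
      }
    ; product = λ (A , A∈K) (B , B∈K) → record
      { A×B      = (A ×ᵈ B) , K-× A∈K B∈K
      ; π₁       = fstˢ A B
      ; π₂       = sndˢ A B
      ; ⟨_,_⟩    = pairˢ
      ; project₁ = λ _ → Dcpo.Eq.refl A
      ; project₂ = λ _ → Dcpo.Eq.refl B
      ; unique   = λ h π₁h≈f π₂h≈g x → π₁h≈f x , π₂h≈g x
      }
    ; exponential = λ (A , A∈K) (B , B∈K) → record
      { B^A    = (A ⇒ᵈ B) , K-⇒ A∈K B∈K
      ; eval   = evalˢ A B
      ; curry  = curryˢ A B
      ; β      = λ _ → Dcpo.Eq.refl B
      ; unique = λ h eval-h≈g x y → eval-h≈g (x , y)
      }
    }

  -- For X in K, maps X → E factor through r uniquely up to ≈. E is not assumed to lie in K, so its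
  -- identity cannot be lifted; the inverse of r is assembled from points.
  module Represented {k} (K : Pred (Dcpo ℓ) k) {R E : Dcpo ℓ}
    (r : ScottMap R E)
    (lift : ∀ {X} → K X → ScottMap X E → ScottMap X R)
    (r-lift : ∀ {X} (X∈K : K X) h x → Dcpo._≈_ E (to r (to (lift X∈K h) x)) (to h x))
    (r-monic : ∀ {X} → K X → (g h : ScottMap X R) →
               (∀ x → Dcpo._≈_ E (to r (to g x)) (to r (to h x))) →
               ∀ x → Dcpo._≈_ R (to g x) (to h x))
    {X₀} (X₀∈K : K X₀) (x₀ : Dcpo.Carrier X₀)
    (nontrivial : ∀ y z → Dcpo._≤_ E y z → ¬ Dcpo._≤_ E z y →
                  ∃ λ X → K X × ∃₂ λ u v → Dcpo._≤_ X u v × ¬ Dcpo._≤_ X v u)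
    where
    private
      module R = Dcpo R
      module E = Dcpo E

    -- Points of R are treated as constant maps from X₀, to which `r-monic` applies.
    r-injective : ∀ {x y} → to r x E.≈ to r y → x R.≈ y
    r-injective {x} {y} rx≈ry = r-monic X₀∈K (constˢ x) (constˢ y) (λ _ → rx≈ry) x₀

    r-reflects-≤ : ∀ {x y} → to r x E.≤ to r y → x R.≤ y
    r-reflects-≤ {x} {y} rx≤ry with em {to r y E.≤ to r x}
    ... | yes ry≤rx = R.reflexive (r-injective (E.antisym rx≤ry ry≤rx))
    ... | no  ry≰rx =
      let (X , X∈K , u , v , u≤v , v≰u) = nontrivial _ _ rx≤ry ry≰rx
          -- The lift of this map takes u and v to points over r x and r y, hence to x and y by
          -- injectivity; its monotonicity gives x ≤ y.
          h   = stepˢ X E u rx≤ry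
          x≈u = r-injective (E.Eq.trans (r-lift X∈K h u)
                  (E.Eq.reflexive (step-≤ X E u rx≤ry (Dcpo.refl X))))
          y≈v = r-injective (E.Eq.trans (r-lift X∈K h v)
                  (E.Eq.reflexive (step-≰ X E u rx≤ry v≰u)))
      in R.trans (R.reflexive (R.Eq.sym x≈u))
           (R.trans (ScottMap.mono (lift X∈K h) u≤v) (R.reflexive y≈v))

    private
      point : E.Carrier → R.Carrier
      point z = to (lift X₀∈K (constˢ z)) x₀

    r-point : ∀ z → to r (point z) E.≈ z
    r-point z = r-lift X₀∈K (constˢ z) x₀

    private
      point-mono : ∀ {z w} → z E.≤ w → point z R.≤ point w
      point-mono z≤w = r-reflects-≤ (E.trans (E.reflexive (r-point _))
        (E.trans z≤w (E.reflexive (E.Eq.sym (r-point _)))))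

    -- If u bounds the points over S, then r u bounds S and so lies above s; reflecting this
    -- inequality along r gives continuity.
    section : ScottMap E R
    section = record
      { to       = point
      ; mono     = point-mono
      ; pres-sup = λ S S-dir s s-sup →
          (λ (z , z∈S , x≈) → R.trans (R.reflexive x≈)
             (point-mono (proj₁ s-sup z∈S))) ,
          (λ u u-ub → r-reflects-≤ (E.trans (E.reflexive (r-point s))
             (proj₂ s-sup (to r u) λ {z} z∈S →
               E.trans (E.reflexive (E.Eq.sym (r-point z)))
                 (ScottMap.mono r (u-ub (z , z∈S , R.Eq.refl))))))
      }

  -- Abstract products and exponentials compared with the concrete ones.

  module _ {k} (K : Pred (Dcpo ℓ) k) {X₀} (X₀∈K : K X₀) (x₀ : Dcpo.Carrier X₀)
           (ccc : CartesianClosed (FullSubcategory (DCPO em) K)) where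
    open CartesianClosed ccc
    open Category (FullSubcategory (DCPO em) K) using (Obj)

    module RepresentedProduct (A B : Obj) where
      private
        module A = Dcpo (proj₁ A)
        module B = Dcpo (proj₁ B)
        fst = fstˢ (proj₁ A) (proj₁ B)
        snd = sndˢ (proj₁ A) (proj₁ B)
      open Product (product A B) public

      -- Strictness must occur in one of the two coordinates, and both factors lie in K.
      nontrivial-× : ∀ y z → Dcpo._≤_ (proj₁ A ×ᵈ proj₁ B) y z →
        ¬ Dcpo._≤_ (proj₁ A ×ᵈ proj₁ B) z y →
        ∃ λ X → K X × ∃₂ λ u v → Dcpo._≤_ X u v × ¬ Dcpo._≤_ X v u
      nontrivial-× (y₁ , y₂) (z₁ , z₂) (y₁≤z₁ , y₂≤z₂) z≰y with em {z₁ A.≤ y₁}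
      ... | no  z₁≰y₁ = _ , proj₂ A , y₁ , z₁ , y₁≤z₁ , z₁≰y₁
      ... | yes z₁≤y₁ =
        _ , proj₂ B , y₂ , z₂ , y₂≤z₂ , λ z₂≤y₂ → z≰y (z₁≤y₁ , z₂≤y₂)

      pairing : ScottMap (proj₁ A×B) (proj₁ A ×ᵈ proj₁ B)
      pairing = pairˢ π₁ π₂

      pairing-lift : ∀ {X} → K X → ScottMap X (proj₁ A ×ᵈ proj₁ B) →
                     ScottMap X (proj₁ A×B)
      pairing-lift X∈K h = ⟨_,_⟩ {X = _ , X∈K} (fst ∘ˢ h) (snd ∘ˢ h)

      pairing-∘-lift : ∀ {X} (X∈K : K X) h x →
        Dcpo._≈_ (proj₁ A ×ᵈ proj₁ B) (to pairing (to (pairing-lift X∈K h) x)) (to h x)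
      pairing-∘-lift X∈K h x = project₁ {X = _ , X∈K} {fst ∘ˢ h} {snd ∘ˢ h} x ,
                               project₂ {X = _ , X∈K} {fst ∘ˢ h} {snd ∘ˢ h} x

      pairing-monic : ∀ {X} → K X → (g h : ScottMap X (proj₁ A×B)) →
        (∀ x → Dcpo._≈_ (proj₁ A ×ᵈ proj₁ B) (to pairing (to g x))
                                             (to pairing (to h x))) →
        ∀ x → Dcpo._≈_ (proj₁ A×B) (to g x) (to h x)
      pairing-monic X∈K g h g≈h x =
        -- Both g and h are shown to be the pairing of π₁ h and π₂ h.
        let unique′ = unique {X = _ , X∈K} {π₁ ∘ˢ h} {π₂ ∘ˢ h}
        in Dcpo.Eq.trans (proj₁ A×B)
             (unique′ g (λ y → proj₁ (g≈h y)) (λ y → proj₂ (g≈h y)) x)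
             (Dcpo.Eq.sym (proj₁ A×B)
               (unique′ h (λ _ → A.Eq.refl) (λ _ → B.Eq.refl) x))

      open Represented K {proj₁ A×B} {proj₁ A ×ᵈ proj₁ B}
        pairing pairing-lift pairing-∘-lift pairing-monic
        X₀∈K x₀ nontrivial-× public

    module RepresentedExponential (A B : Obj) where
      private
        module A = Dcpo (proj₁ A)
        module B = Dcpo (proj₁ B)
      open Exponential (exponential A B)
      module P (X : Obj) = RepresentedProduct X A

      -- `eval` is defined on the abstract product, so `section` first leads there from the concrete
      -- one.
      represented : ScottMap (proj₁ B^A) (proj₁ A ⇒ᵈ proj₁ B)
      represented = curryˢ (proj₁ A) (proj₁ B) (eval ∘ˢ P.section B^A)

      -- Translates the abstract h × id into `represented`: its value at w and the section of (h (π₁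
      -- w) , π₂ w) have the same projections, so injectivity of the pairing identifies them.
      eval-×id : ∀ {X} (h : ScottMap (proj₁ X) (proj₁ B^A)) w →
        to eval (to (_×id {X} {B^A} h) w) B.≈
        to (to represented (to h (to (P.π₁ X) w))) (to (P.π₂ X) w)
      eval-×id {X} h w = ScottMap.cong eval (P.r-injective B^A
        (Dcpo.Eq.trans (proj₁ B^A ×ᵈ proj₁ A)
          ( P.project₁ B^A {P.A×B X} {h ∘ˢ P.π₁ X} {P.π₂ X} w
          , P.project₂ B^A {P.A×B X} {h ∘ˢ P.π₁ X} {P.π₂ X} w )
          (Dcpo.Eq.sym (proj₁ B^A ×ᵈ proj₁ A) (P.r-point B^A _))))

      uncurryᴷ : (X : Obj) → ScottMap (proj₁ X) (proj₁ A ⇒ᵈ proj₁ B) →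
                 ScottMap (proj₁ (X ×A)) (proj₁ B)
      uncurryᴷ X h = evalˢ (proj₁ A) (proj₁ B) ∘ˢ pairˢ (h ∘ˢ P.π₁ X) (P.π₂ X)

      represented-cong : ∀ {φ ψ x y} → Dcpo._≈_ (proj₁ B^A) φ ψ → x A.≈ y →
        to (to represented φ) x B.≈ to (to represented ψ) y
      represented-cong {φ} {ψ} {x} φ≈ψ x≈y = B.Eq.trans
        (ScottMap.cong represented φ≈ψ x) (ScottMap.cong (to represented ψ) x≈y)

      -- A failing inequality of maps fails at some argument, and the two values there form a strict
      -- pair in B.
      nontrivial-⇒ : ∀ (φ ψ : ScottMap (proj₁ A) (proj₁ B)) →
        Dcpo._≤_ (proj₁ A ⇒ᵈ proj₁ B) φ ψ → ¬ Dcpo._≤_ (proj₁ A ⇒ᵈ proj₁ B) ψ φ →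
        ∃ λ X → K X × ∃₂ λ u v → Dcpo._≤_ X u v × ¬ Dcpo._≤_ X v u
      nontrivial-⇒ φ ψ φ≤ψ ψ≰φ with em {∃ λ x → ¬ to ψ x B.≤ to φ x}
      ... | yes (x , ψx≰φx) = _ , proj₂ B , to φ x , to ψ x , φ≤ψ x , ψx≰φx
      ... | no  none        = ⊥-elim (ψ≰φ λ x → below x em)
        where
        below : ∀ x → Dec (to ψ x B.≤ to φ x) → to ψ x B.≤ to φ x
        below x (yes ψx≤φx) = ψx≤φx
        below x (no  ψx≰φx) = ⊥-elim (none (x , ψx≰φx))

      represented-lift : ∀ {X} → K X → ScottMap X (proj₁ A ⇒ᵈ proj₁ B) →
                         ScottMap X (proj₁ B^A)
      represented-lift X∈K h = curry {X = _ , X∈K} (uncurryᴷ (_ , X∈K) h)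

      represented-∘-lift : ∀ {X} (X∈K : K X) (h : ScottMap X (proj₁ A ⇒ᵈ proj₁ B)) x →
        Dcpo._≈_ (proj₁ A ⇒ᵈ proj₁ B)
          (to represented (to (represented-lift X∈K h) x)) (to h x)
      represented-∘-lift {X} X∈K h x y =
        let X′ = X , X∈K
            -- w represents (x , y) in the abstract product, where `β` applies. Its projections
            -- equal x and y up to ≈, hence the congruences on either side.
            w  = to (P.section X′) (x , y)
            k  = represented-lift X∈K h
            (π₁w≈x , π₂w≈y) = P.r-point X′ (x , y)
        in B.Eq.trans
             (represented-cong (ScottMap.cong k (Dcpo.Eq.sym X π₁w≈x))
                               (A.Eq.sym π₂w≈y))
             (B.Eq.trans (B.Eq.sym (eval-×id k w))
             (B.Eq.trans (β {X = X′} {uncurryᴷ X′ h} w)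
             (B.Eq.trans (ScottMap.cong h π₁w≈x (to (P.π₂ X′) w))
                         (ScottMap.cong (to h x) π₂w≈y))))

      represented-monic : ∀ {X} → K X → (g h : ScottMap X (proj₁ B^A)) →
        (∀ x → Dcpo._≈_ (proj₁ A ⇒ᵈ proj₁ B) (to represented (to g x))
                                             (to represented (to h x))) →
        ∀ x → Dcpo._≈_ (proj₁ B^A) (to g x) (to h x)
      represented-monic {X} X∈K g h g≈h x =
        let X′ = X , X∈K
            -- Both g and h are shown to be the currying of eval ∘ (h × id).
            unique′ = unique {X = X′} {eval ∘ˢ _×id {X′} {B^A} h}
        in Dcpo.Eq.trans (proj₁ B^A)
             (unique′ g (λ w → B.Eq.trans (eval-×id g w)
                (B.Eq.trans (g≈h (to (P.π₁ X′) w) (to (P.π₂ X′) w))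
                            (B.Eq.sym (eval-×id h w)))) x)
             (Dcpo.Eq.sym (proj₁ B^A) (unique′ h (λ _ → B.Eq.refl) x))

      open Represented K {proj₁ B^A} {proj₁ A ⇒ᵈ proj₁ B}
        represented represented-lift represented-∘-lift represented-monic
        X₀∈K x₀ nontrivial-⇒ public

theorem4p9 : ∀ {ℓ c} (em : ExcludedMiddle ℓ)
    (C : Dcpo ℓ → Set c) → ∃ C →
    (∀ D → C D → Pointed D × CountablyBased D × IsFSDomain D) →
    CartesianClosed (𝓕-category em C) ⇔
    (∀ C₁ C₂ → C C₁ → C C₂ → 𝓕 C (C₁ ×ᵈ C₂) × 𝓕 C (C₁ ⇒ᵈ C₂))
theorem4p9 em C (C₀ , C₀∈C) C-domains = mk⇔ necessary sufficient
  where
  open Theory em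

  -- The least element serves as the base point x₀ and as the point needed for `𝓕-𝟙`.
  ⊥₀ = proj₁ (proj₁ (C-domains C₀ C₀∈C))

  necessary : CartesianClosed (𝓕-category em C) →
    ∀ C₁ C₂ → C C₁ → C C₂ → 𝓕 C (C₁ ×ᵈ C₂) × 𝓕 C (C₁ ⇒ᵈ C₂)
  necessary ccc C₁ C₂ C₁∈C C₂∈C =
    𝓕-retract C Prod.pairing Prod.section Prod.r-point (proj₂ Prod.A×B) ,
    𝓕-retract C Exp.represented Exp.section Exp.r-point (proj₂ (Exponential.B^A exp))
    where
    A₁ = C₁ , C⊆𝓕 C C₁∈C
    A₂ = C₂ , C⊆𝓕 C C₂∈C
    exp = CartesianClosed.exponential ccc A₁ A₂
    module Prod = RepresentedProduct (𝓕 C) (C⊆𝓕 C C₀∈C) ⊥₀ ccc A₁ A₂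
    module Exp = RepresentedExponential (𝓕 C) (C⊆𝓕 C C₀∈C) ⊥₀ ccc A₁ A₂

  sufficient :
    (∀ C₁ C₂ → C C₁ → C C₂ → 𝓕 C (C₁ ×ᵈ C₂) × 𝓕 C (C₁ ⇒ᵈ C₂)) →
    CartesianClosed (𝓕-category em C)
  sufficient closed = full-ccc (𝓕 C) (𝓕-𝟙 C₀∈C ⊥₀)
    (λ 𝒟 ℰ → idempotent (𝓕-× 𝒟 ℰ λ m n →
       proj₁ (closed _ _ (𝓕.obj∈C 𝒟 m) (𝓕.obj∈C ℰ n))))
    (λ 𝒟 ℰ → idempotent (𝓕-⇒ 𝒟 ℰ λ m n →
       proj₂ (closed _ _ (𝓕.obj∈C 𝒟 m) (𝓕.obj∈C ℰ n))))
    where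
    idempotent : ∀ {D} → 𝓕 (𝓕 C) D → 𝓕 C D
    idempotent = 𝓕𝓕⊆𝓕 λ {D} D∈C →
      let (_ , based , fs) = C-domains D D∈C in C⊆𝓕ˢ C D∈C based fs
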